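{- Let $T$ be a triangulation of the annulus $C_{p,q}$ and $Q_T$ its associated quiver. Then $Q_{D_z^{+\infty}(T)}\cong Q_{D_z^{ -\infty}(T)}$.
   Context: $C_{p,q}$ is an annulus with $p>0$ marked points on the outer boundary $\partial$ and $q>0$ on the inner boundary $\partial'$, oriented counter-clockwise; $z$ is a non-contractible simple closed curve in it. Arcs are taken up to isotopy; a triangulation is a maximal collection of pairwise non-crossing arcs. The quiver $Q_T$ of a (possibly asymptotic) triangulation has a vertex for each arc $d_i$ and an arrow $i\to j$ whenever $d_i,d_j$ bound a common triangle and $d_j$ is a clockwise rotation of $d_i$ about their common endpoint. For a marked point $m$, the Prüfer arc $\pi_m$ is the arc starting at $m$ spiralling positively around the annulus towards $z$, and the adic arc $\alpha_m$ the one spiralling negatively. The positive Dehn twist $D_z$ rotates the inner boundary clockwise by $2\pi$; $D_z^{+\infty}=\lim_{n\to\infty}D_z^n$ and $D_z^{ -\infty}=\lim_{n\to-\infty}D_z^n$. Concretely, a bridging arc $[i,j]$ (endpoints on different boundary components) is sent by $D_z^{+\infty}$ to $\{\pi_i,\pi_j\}$ and by $D_z^{ -\infty}$ to $\{\alpha_i,\alpha_j\}$, peripheral arcs (both endpoints on the same boundary component) are fixed, and $D_z^{\pm\infty}(T)=\bigcup_{\gamma\in T}D_z^{\pm\infty}\cdot\gamma$. -}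

module Defs where

open import Data.Bool using (Bool; true; false; _∧_; _∨_; not; if_then_else_; T)
open import Data.Bool.ListAction using (any)
open import Data.Nat as ℕ using (ℕ; NonZero)
open import Data.Integer as ℤ using (ℤ; +_)
open import Data.Integer.DivMod using (_/ℕ_; _%ℕ_; n%ℕd<d)
open import Data.Fin as Fin using (Fin; toℕ; fromℕ<)
open import Data.Fin.Properties using () renaming (_≟_ to _≟ᶠ_)
open import Data.List using (List; []; _∷_; _++_; concatMap; deduplicate; filter; map; allFin; cartesianProduct)
open import Data.List.Membership.Propositional using (_∈_)
open import Data.List.Relation.Binary.Permutation.Propositional using (_↭_)
open import Data.List.Relation.Unary.Any using (any?)
open import Data.Product using (_×_; _,_; Σ; ∃; proj₁; proj₂)
open import Relation.Binary.PropositionalEquality using (_≡_; refl; cong; cong₂)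
open import Relation.Nullary using (¬_; Dec; yes; no; ⌊_⌋)
open import Relation.Nullary.Decidable using (map′)
open import Relation.Binary using (DecidableEquality)

-- Combinatorial model of the annulus C_{p,q} via its universal cover,
-- the strip ℝ × [0,1].  The outer boundary ∂ is the bottom line, whose
-- marked points lift to the integers ℤ (lift n lies over outer marked
-- point n mod p); the inner boundary ∂' is the top line, marked points
-- lifted to ℤ (n over inner point n mod q).  Counter-clockwise on both
-- boundary components is "to the right" (increasing n), and the strip
-- carries the standard orientation.  The deck transformation is
-- (outer n , inner m) ↦ (n + p , m + q).  The positive Dehn twist D_z
-- acts on lifts of bridging arcs by (a , b) ↦ (a , b - q).

module Annulus (p q : ℕ) .{{_ : NonZero p}} .{{_ : NonZero q}} where

  ptO : ℤ → Fin p
  ptO n = fromℕ< (n%ℕd<d n p)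

  ptI : ℤ → Fin q
  ptI n = fromℕ< (n%ℕd<d n q)

  -- Ordinary arcs, one canonical representative per isotopy class.
  data OArc : Set where
    -- bridging arc: the lift joining outer lift a ∈ {0..p-1} to inner lift b ∈ ℤ
    bridge : Fin p → ℤ → OArc
    -- peripheral arc on ∂ : lift joining outer lifts s and s + k
    outerP : Fin p → ℕ → OArc
    -- peripheral arc on ∂' : lift joining inner lifts s and s + k
    innerP : Fin q → ℕ → OArc

  -- genuine arcs: not isotopic to a boundary segment (k ≥ 2) and
  -- simple, i.e. not crossing their own translates (k ≤ p resp. k ≤ q)
  Valid : OArc → Set
  Valid (bridge a b) = Data.Unit.⊤ where import Data.Unit
  Valid (outerP s k) = 2 ℕ.≤ k × k ℕ.≤ p
  Valid (innerP s k) = 2 ℕ.≤ k × k ℕ.≤ q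

  data AArc : Set where
    arc     : OArc → AArc
    prüferO : Fin p → AArc
    adicO   : Fin p → AArc
    prüferI : Fin q → AArc
    adicI   : Fin q → AArc

  data Lift : Set where
    brL : ℤ → ℤ → Lift   -- outer endpoint, inner endpoint
    opL : ℤ → ℤ → Lift   -- outer endpoints c < d
    ipL : ℤ → ℤ → Lift   -- inner endpoints c < d

  lift : ℤ → OArc → Lift   -- the m-th deck translate of the canonical lift
  lift m (bridge a b) = brL (+ toℕ a ℤ.+ m ℤ.* + p) (b ℤ.+ m ℤ.* + q)
  lift m (outerP s k) = opL (+ toℕ s ℤ.+ m ℤ.* + p) (+ toℕ s ℤ.+ + k ℤ.+ m ℤ.* + p)
  lift m (innerP s k) = ipL (+ toℕ s ℤ.+ m ℤ.* + q) (+ toℕ s ℤ.+ + k ℤ.+ m ℤ.* + q)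

  CrossL : Lift → Lift → Set
  CrossL (brL a b) (brL c d) = (a ℤ.< c × d ℤ.< b) Data.Sum.⊎ (c ℤ.< a × b ℤ.< d) where import Data.Sum
  CrossL (brL a b) (opL c d) = c ℤ.< a × a ℤ.< d
  CrossL (brL a b) (ipL c d) = c ℤ.< b × b ℤ.< d
  CrossL (opL c d) (brL a b) = c ℤ.< a × a ℤ.< d
  CrossL (ipL c d) (brL a b) = c ℤ.< b × b ℤ.< d
  CrossL (opL a b) (opL c d) = (a ℤ.< c × c ℤ.< b × b ℤ.< d) Data.Sum.⊎ (c ℤ.< a × a ℤ.< d × d ℤ.< b) where import Data.Sum
  CrossL (ipL a b) (ipL c d) = (a ℤ.< c × c ℤ.< b × b ℤ.< d) Data.Sum.⊎ (c ℤ.< a × a ℤ.< d × d ℤ.< b) where import Data.Sum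
  CrossL (opL _ _) (ipL _ _) = Data.Empty.⊥ where import Data.Empty
  CrossL (ipL _ _) (opL _ _) = Data.Empty.⊥ where import Data.Empty

  Cross : OArc → OArc → Set
  Cross γ δ = ∃ λ (m : ℤ) → CrossL (lift (+ 0) γ) (lift m δ)

  record IsTriangulation (T : List OArc) : Set where
    field
      valid       : ∀ {γ} → γ ∈ T → Valid γ
      noncrossing : ∀ {γ δ} → γ ∈ T → δ ∈ T → ¬ Cross γ δ
      maximal     : ∀ γ → Valid γ → (∀ {δ} → δ ∈ T → ¬ Cross γ δ) → γ ∈ T

  Dplus : List OArc → List AArc
  Dplus = concatMap f
    where
    f : OArc → List AArc
    f (bridge a b) = prüferO a ∷ prüferI (ptI b) ∷ []
    f γ            = arc γ ∷ []

  Dminus : List OArc → List AArc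
  Dminus = concatMap f
    where
    f : OArc → List AArc
    f (bridge a b) = adicO a ∷ adicI (ptI b) ∷ []
    f γ            = arc γ ∷ []

  _≟O_ : DecidableEquality OArc
  bridge a b ≟O bridge c d with a ≟ᶠ c | b ℤ.≟ d
  ... | yes refl | yes refl = yes refl
  ... | no ne | _ = no λ { refl → ne refl }
  ... | _ | no ne = no λ { refl → ne refl }
  outerP a b ≟O outerP c d with a ≟ᶠ c | b ℕ.≟ d
  ... | yes refl | yes refl = yes refl
  ... | no ne | _ = no λ { refl → ne refl }
  ... | _ | no ne = no λ { refl → ne refl }
  innerP a b ≟O innerP c d with a ≟ᶠ c | b ℕ.≟ d
  ... | yes refl | yes refl = yes refl
  ... | no ne | _ = no λ { refl → ne refl }
  ... | _ | no ne = no λ { refl → ne refl }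
  bridge _ _ ≟O outerP _ _ = no λ ()
  bridge _ _ ≟O innerP _ _ = no λ ()
  outerP _ _ ≟O bridge _ _ = no λ ()
  outerP _ _ ≟O innerP _ _ = no λ ()
  innerP _ _ ≟O bridge _ _ = no λ ()
  innerP _ _ ≟O outerP _ _ = no λ ()

  _≟A_ : DecidableEquality AArc
  arc γ ≟A arc δ with γ ≟O δ
  ... | yes refl = yes refl
  ... | no ne = no λ { refl → ne refl }
  prüferO a ≟A prüferO b with a ≟ᶠ b
  ... | yes refl = yes refl
  ... | no ne = no λ { refl → ne refl }
  adicO a ≟A adicO b with a ≟ᶠ b
  ... | yes refl = yes refl
  ... | no ne = no λ { refl → ne refl }
  prüferI a ≟A prüferI b with a ≟ᶠ b
  ... | yes refl = yes refl
  ... | no ne = no λ { refl → ne refl }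
  adicI a ≟A adicI b with a ≟ᶠ b
  ... | yes refl = yes refl
  ... | no ne = no λ { refl → ne refl }
  arc _ ≟A prüferO _ = no λ ()
  arc _ ≟A adicO _ = no λ ()
  arc _ ≟A prüferI _ = no λ ()
  arc _ ≟A adicI _ = no λ ()
  prüferO _ ≟A arc _ = no λ ()
  prüferO _ ≟A adicO _ = no λ ()
  prüferO _ ≟A prüferI _ = no λ ()
  prüferO _ ≟A adicI _ = no λ ()
  adicO _ ≟A arc _ = no λ ()
  adicO _ ≟A prüferO _ = no λ ()
  adicO _ ≟A prüferI _ = no λ ()
  adicO _ ≟A adicI _ = no λ ()
  prüferI _ ≟A arc _ = no λ ()
  prüferI _ ≟A prüferO _ = no λ ()
  prüferI _ ≟A adicO _ = no λ ()
  prüferI _ ≟A adicI _ = no λ ()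
  adicI _ ≟A arc _ = no λ ()
  adicI _ ≟A prüferO _ = no λ ()
  adicI _ ≟A adicO _ = no λ ()
  adicI _ ≟A prüferI _ = no λ ()

  _==ᶠ_ : ∀ {n} → Fin n → Fin n → Bool
  a ==ᶠ b = ⌊ a ≟ᶠ b ⌋

  _<ᶻ_ : ℤ → ℤ → Bool
  x <ᶻ y = ⌊ x ℤ.<? y ⌋

  _<ⁿ_ : ℕ → ℕ → Bool
  x <ⁿ y = ⌊ x ℕ.<? y ⌋

  -- Ends of arcs at a marked point, listed in clockwise order.
  --
  -- At an outer marked point c (bottom of the strip, interior above),
  -- turning clockwise goes from the left to the right:
  --   (c-2,c), (c-3,c), …, (c-p,c), π_c (spirals to the left),
  --   bridging (c,b) for b increasing, α_c (spirals to the right),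
  --   (c,c+p), …, (c,c+2).

  data OEnd : Set where
    lpO  : ℕ → OEnd      -- peripheral arc (c-k , c)
    πO   : OEnd
    brO  : ℤ → OEnd      -- bridging lift (c , b)
    αO   : OEnd
    rpO  : ℕ → OEnd      -- peripheral arc (c , c+k)

  _≺O_ : OEnd → OEnd → Bool
  lpO k ≺O lpO k' = k <ⁿ k'
  lpO _ ≺O _      = true
  πO    ≺O lpO _  = false
  πO    ≺O πO     = false
  πO    ≺O _      = true
  brO b ≺O brO b' = b <ᶻ b'
  brO _ ≺O αO     = true
  brO _ ≺O rpO _  = true
  brO _ ≺O _      = false
  αO    ≺O rpO _  = true
  αO    ≺O _      = false
  rpO k ≺O rpO k' = k' <ⁿ k
  rpO _ ≺O _      = false

  -- At an inner marked point d (top of the strip, interior below),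
  -- turning clockwise goes from the right to the left:
  --   (d,d+2), …, (d,d+q), π_d (spirals to the right),
  --   bridging (a,d) for a decreasing, α_d (spirals to the left),
  --   (d-q,d), …, (d-2,d).

  data IEnd : Set where
    rpI  : ℕ → IEnd      -- peripheral arc (d , d+k)
    πI   : IEnd
    brI  : ℤ → IEnd      -- bridging lift (a , d)
    αI   : IEnd
    lpI  : ℕ → IEnd      -- peripheral arc (d-k , d)

  _≺I_ : IEnd → IEnd → Bool
  rpI k ≺I rpI k' = k <ⁿ k'
  rpI _ ≺I _      = true
  πI    ≺I rpI _  = false
  πI    ≺I πI     = false
  πI    ≺I _      = true
  brI a ≺I brI a' = a' <ᶻ a
  brI _ ≺I αI     = true
  brI _ ≺I lpI _  = true
  brI _ ≺I _      = false
  αI    ≺I lpI _  = true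
  αI    ≺I _      = false
  lpI k ≺I lpI k' = k' <ⁿ k
  lpI _ ≺I _      = false

  opt : ∀ {A : Set} → Bool → A → List A
  opt b x = if b then x ∷ [] else []

  endsO : Fin p → AArc → List (OEnd × AArc)
  endsO c γ@(arc (bridge a b)) = opt (a ==ᶠ c) (brO b , γ)
  endsO c γ@(arc (outerP s k)) =
    opt (s ==ᶠ c) (rpO k , γ) ++ opt (ptO (+ toℕ s ℤ.+ + k) ==ᶠ c) (lpO k , γ)
  endsO c (arc (innerP _ _)) = []
  endsO c γ@(prüferO s) = opt (s ==ᶠ c) (πO , γ)
  endsO c γ@(adicO s)   = opt (s ==ᶠ c) (αO , γ)
  endsO c (prüferI _) = []
  endsO c (adicI _)   = []

  endsI : Fin q → AArc → List (IEnd × AArc)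
  endsI d γ@(arc (bridge a b)) =
    let m = b ℤ.- + toℕ d in
    opt (m %ℕ q ℕ.≡ᵇ 0) (brI (+ toℕ a ℤ.- (m /ℕ q) ℤ.* + p) , γ)
  endsI d γ@(arc (innerP s k)) =
    opt (s ==ᶠ d) (rpI k , γ) ++ opt (ptI (+ toℕ s ℤ.+ + k) ==ᶠ d) (lpI k , γ)
  endsI d (arc (outerP _ _)) = []
  endsI d γ@(prüferI s) = opt (s ==ᶠ d) (πI , γ)
  endsI d γ@(adicI s)   = opt (s ==ᶠ d) (αI , γ)
  endsI d (prüferO _) = []
  endsI d (adicO _)   = []

  -- arrows at a vertex: consecutive ends in clockwise order, d_i → d_j
  -- where d_j is the clockwise neighbour of d_i (they bound a common triangle)
  cornerArrows : {E : Set} → (E → E → Bool) → List (E × AArc) → List (AArc × AArc)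
  cornerArrows {E} _≺_ es =
    map (λ { ((_ , γ) , (_ , δ)) → γ , δ })
        (filter (λ { ((e , γ) , (e' , δ)) →
                       Relation.Nullary.Decidable.T? (consecutive e e' ∧ not ⌊ γ ≟A δ ⌋) })
                (cartesianProduct es es))
    where
    consecutive : E → E → Bool
    consecutive e e' = (e ≺ e') ∧ not (any (λ x → (e ≺ proj₁ x) ∧ (proj₁ x ≺ e')) es)

  -- Arrows at the ideal vertex where spirals of one kind accumulate on z.
  -- For consecutive lifts c < c' of starting points of such spirals,
  -- the region between them is a triangle with sides the two spirals and
  -- the arc (or boundary segment) [c,c']; the clockwise arrow at the ideal
  -- vertex is  spiral(c') → spiral(c)  on the outer side and
  -- spiral(c) → spiral(c')  on the inner side.
  -- 'next n P c' = the next element of P after c, going around Fin n cyclically.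
  idealArrows : (n : ℕ) → (Fin n → AArc) → Bool → List AArc → List (AArc × AArc)
  idealArrows n sp outerSide L = concatMap arrowsFrom (allFin n)
    where
    present : Fin n → Bool
    present c = any (λ γ → ⌊ sp c ≟A γ ⌋) L
    -- cyclic distance from c to c' in {1, …, n}
    dist : Fin n → Fin n → ℕ
    dist c c' = if toℕ c <ⁿ toℕ c' then toℕ c' ℕ.∸ toℕ c else (n ℕ.+ toℕ c') ℕ.∸ toℕ c
    isNext : Fin n → Fin n → Bool
    isNext c c' = present c ∧ present c' ∧ not (c ==ᶠ c')
                  ∧ not (any (λ c'' → present c'' ∧ not (c'' ==ᶠ c) ∧ (dist c c'' <ⁿ dist c c')) (allFin n))
    arrowsFrom : Fin n → List (AArc × AArc)
    arrowsFrom c = concatMap (λ c' → opt (isNext c c') (if outerSide then (sp c' , sp c) else (sp c , sp c'))) (allFin n)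

  -- The quiver Q_S of a (possibly asymptotic) triangulation S, given as a
  -- list of arcs: vertices are the distinct arcs of S, arrows a list of
  -- (source , target) pairs counted with multiplicity.

  record Quiver : Set where
    field
      vertices : List AArc
      arrows   : List (AArc × AArc)

  quiver : List AArc → Quiver
  quiver L = record
    { vertices = V
    ; arrows   = concatMap (λ c → cornerArrows _≺O_ (concatMap (endsO c) V)) (allFin p)
              ++ concatMap (λ d → cornerArrows _≺I_ (concatMap (endsI d) V)) (allFin q)
              ++ idealArrows p prüferO true V
              ++ idealArrows p adicO true V
              ++ idealArrows q prüferI false V
              ++ idealArrows q adicI false V
    }
    where V = deduplicate _≟A_ L

  -- Quiver isomorphism: a map on arcs restricting to a bijection between
  -- the (duplicate-free) vertex lists and carrying the arrow multiset of
  -- the first quiver onto that of the second.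
  _≅Q_ : Quiver → Quiver → Set
  Q ≅Q Q' = Σ (AArc → AArc) λ f →
      (map f (Quiver.vertices Q) ↭ Quiver.vertices Q')
    × (map (λ { (γ , δ) → f γ , f δ }) (Quiver.arrows Q) ↭ Quiver.arrows Q')

-- The two limits differ only in the direction of the spirals: D_z^{-∞}(T) is obtained from
-- D_z^{+∞}(T) by replacing every Prüfer arc π_m by the adic arc α_m, and neither contains a
-- bridging arc.  At a marked point the ends of π_m and α_m are separated only by ends of
-- bridging arcs, so once these are absent the swap π ↔ α preserves the clockwise order of the
-- ends that occur, hence the arrows at every marked point.  At the limit vertex on z the
-- arrows between Prüfer arcs of the one triangulation are those between the corresponding
-- adic arcs of the other.  So the swap is a quiver isomorphism.
module Submission where

open import Defs
open import Data.Bool using (Bool; true; false; _∧_; not; if_then_else_)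
open import Data.Bool.ListAction using (any; or)
open import Data.Fin using (Fin; toℕ)
open import Data.List using (List; []; _∷_; _++_; map; filter; concatMap; deduplicate; cartesianProduct; allFin)
open import Data.List.Properties using (map-∘; map-cong; map-cong-local; map-++; concatMap-cong; concatMap-map; map-concatMap)
open import Data.List.Relation.Unary.All as All using (All; []; _∷_)
open import Data.List.Membership.Propositional using (_∈_)
open import Data.List.Relation.Unary.All.Properties using (++⁺; map⁺; concat⁺; cartesianProduct⁺; deduplicate⁺)
open import Data.List.Relation.Binary.Permutation.Propositional using (_↭_; ↭-trans; ↭-reflexive; module PermutationReasoning)
open import Data.List.Relation.Binary.Permutation.Propositional.Properties using (++⁺ˡ; ++-comm; shifts)
open import Data.Nat using (ℕ; NonZero; _+_; _∸_)
open import Data.Product as Product using (_×_; _,_; proj₁; proj₂)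
open import Data.Integer using (+_)
import Data.Integer as ℤ
open import Function using (_∘_)
open import Function.Definitions using (Injective)
open import Relation.Binary using (DecidableEquality)
open import Relation.Binary.PropositionalEquality as ≡ using (_≡_; refl; sym; trans; cong; cong₂; subst)
open import Relation.Nullary using (yes; no; does; ⌊_⌋; ¬?; T?; contradiction)
open import Relation.Nullary.Decidable using (isYes≗does)
open import Relation.Unary using (Pred; Decidable)
open import Level using (0ℓ)

module _ {A B : Set} where

  filter-map-local : ∀ {P : Pred B 0ℓ} {Q : Pred A 0ℓ} (P? : Decidable P) (Q? : Decidable Q) {f : A → B} {xs} →
                     All (λ x → does (P? (f x)) ≡ does (Q? x)) xs → filter P? (map f xs) ≡ map f (filter Q? xs)
  filter-map-local P? Q? [] = refl
  filter-map-local P? Q? {f} {x ∷ xs} (eq ∷ eqs) with does (P? (f x)) | does (Q? x) | eq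
  ... | true  | .true  | refl = cong (f x ∷_) (filter-map-local P? Q? eqs)
  ... | false | .false | refl = filter-map-local P? Q? eqs

  any-map-local : ∀ {g : B → Bool} {h : A → Bool} {f : A → B} {xs} →
                  All (λ x → g (f x) ≡ h x) xs → any g (map f xs) ≡ any h xs
  any-map-local {xs = xs} eqs = cong or (trans (sym (map-∘ xs)) (map-cong-local eqs))

  does-≟-injective : (_≟ᴬ_ : DecidableEquality A) (_≟ᴮ_ : DecidableEquality B) {f : A → B} →
                     Injective _≡_ _≡_ f → ∀ x y → does (f x ≟ᴮ f y) ≡ does (x ≟ᴬ y)
  does-≟-injective _≟ᴬ_ _≟ᴮ_ {f} f-inj x y with f x ≟ᴮ f y | x ≟ᴬ y
  ... | yes _     | yes _    = refl
  ... | no _      | no _     = refl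
  ... | yes fx≡fy | no x≢y   = contradiction (f-inj fx≡fy) x≢y
  ... | no fx≢fy  | yes refl = contradiction refl fx≢fy

  deduplicate-map-injective : (_≟ᴬ_ : DecidableEquality A) (_≟ᴮ_ : DecidableEquality B) {f : A → B} →
                              Injective _≡_ _≡_ f → ∀ xs →
                              deduplicate _≟ᴮ_ (map f xs) ≡ map f (deduplicate _≟ᴬ_ xs)
  deduplicate-map-injective _≟ᴬ_ _≟ᴮ_ {f} f-inj [] = refl
  deduplicate-map-injective _≟ᴬ_ _≟ᴮ_ {f} f-inj (x ∷ xs) = cong (f x ∷_) (begin
    filter (¬? ∘ (f x ≟ᴮ_)) (deduplicate _≟ᴮ_ (map f xs))
      ≡⟨ cong (filter _) (deduplicate-map-injective _≟ᴬ_ _≟ᴮ_ f-inj xs) ⟩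
    filter (¬? ∘ (f x ≟ᴮ_)) (map f (deduplicate _≟ᴬ_ xs))
      ≡⟨ filter-map-local (¬? ∘ (f x ≟ᴮ_)) (¬? ∘ (x ≟ᴬ_))
           (All.universal (λ y → cong not (does-≟-injective _≟ᴬ_ _≟ᴮ_ f-inj x y)) (deduplicate _≟ᴬ_ xs)) ⟩
    map f (filter (¬? ∘ (x ≟ᴬ_)) (deduplicate _≟ᴬ_ xs)) ∎)
    where open ≡.≡-Reasoning

module _ {A B C D : Set} where

  cartesianProduct-map : (f : A → C) (g : B → D) (xs : List A) (ys : List B) →
                         cartesianProduct (map f xs) (map g ys) ≡ map (Product.map f g) (cartesianProduct xs ys)
  cartesianProduct-map f g [] ys = refl
  cartesianProduct-map f g (x ∷ xs) ys = begin
    map (f x ,_) (map g ys) ++ cartesianProduct (map f xs) (map g ys)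
      ≡⟨ cong₂ _++_ (trans (sym (map-∘ ys)) (map-∘ ys)) (cartesianProduct-map f g xs ys) ⟩
    map (Product.map f g) (map (x ,_) ys) ++ map (Product.map f g) (cartesianProduct xs ys)
      ≡⟨ map-++ (Product.map f g) (map (x ,_) ys) _ ⟨
    map (Product.map f g) (cartesianProduct (x ∷ xs) ys) ∎
    where open ≡.≡-Reasoning

All-concatMap : {A B : Set} {P : A → Set} {Q : B → Set} {F : A → List B} →
                (∀ {x} → P x → All Q (F x)) → ∀ {xs} → All P xs → All Q (concatMap F xs)
All-concatMap F⁺ = concat⁺ ∘ map⁺ ∘ All.map F⁺

module _ (p q : ℕ) {{_ : NonZero p}} {{_ : NonZero q}} where
  open Annulus p q

  flip : AArc → AArc
  flip (arc γ)     = arc γ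
  flip (prüferO a) = adicO a
  flip (adicO a)   = prüferO a
  flip (prüferI a) = adicI a
  flip (adicI a)   = prüferI a

  flip-involutive : ∀ γ → flip (flip γ) ≡ γ
  flip-involutive (arc γ)     = refl
  flip-involutive (prüferO a) = refl
  flip-involutive (adicO a)   = refl
  flip-involutive (prüferI a) = refl
  flip-involutive (adicI a)   = refl

  flip-injective : Injective _≡_ _≡_ flip
  flip-injective {γ} {δ} eq = trans (sym (flip-involutive γ)) (trans (cong flip eq) (flip-involutive δ))

  flipArrow : AArc × AArc → AArc × AArc
  flipArrow = Product.map flip flip

  Dminus≡map-flip-Dplus : ∀ T → Dminus T ≡ map flip (Dplus T)
  Dminus≡map-flip-Dplus []                 = refl
  Dminus≡map-flip-Dplus (bridge a b ∷ T) = cong (λ L → adicO a ∷ adicI (ptI b) ∷ L) (Dminus≡map-flip-Dplus T)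
  Dminus≡map-flip-Dplus (outerP s k ∷ T) = cong (arc (outerP s k) ∷_) (Dminus≡map-flip-Dplus T)
  Dminus≡map-flip-Dplus (innerP s k ∷ T) = cong (arc (innerP s k) ∷_) (Dminus≡map-flip-Dplus T)

  data PeripheralOrPrüfer : AArc → Set where
    outerP  : ∀ s k → PeripheralOrPrüfer (arc (outerP s k))
    innerP  : ∀ s k → PeripheralOrPrüfer (arc (innerP s k))
    prüferO : ∀ a → PeripheralOrPrüfer (prüferO a)
    prüferI : ∀ a → PeripheralOrPrüfer (prüferI a)

  Dplus-peripheralOrPrüfer : ∀ T → All PeripheralOrPrüfer (Dplus T)
  Dplus-peripheralOrPrüfer []                 = []
  Dplus-peripheralOrPrüfer (bridge a b ∷ T) = prüferO a ∷ prüferI (ptI b) ∷ Dplus-peripheralOrPrüfer T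
  Dplus-peripheralOrPrüfer (outerP s k ∷ T) = outerP s k ∷ Dplus-peripheralOrPrüfer T
  Dplus-peripheralOrPrüfer (innerP s k ∷ T) = innerP s k ∷ Dplus-peripheralOrPrüfer T

  -- `cornerArrows _≺_ es` unfolds to
  -- `map (Product.map proj₂ proj₂) (filter (T? ∘ isCorner _≺_ es) (cartesianProduct es es))`.
  consecutive : {E : Set} → (E → E → Bool) → List (E × AArc) → E → E → Bool
  consecutive _≺_ es e e' = (e ≺ e') ∧ not (any (λ x → (e ≺ proj₁ x) ∧ (proj₁ x ≺ e')) es)

  isCorner : {E : Set} → (E → E → Bool) → List (E × AArc) → (E × AArc) × (E × AArc) → Bool
  isCorner _≺_ es ((e , γ) , (e' , δ)) = consecutive _≺_ es e e' ∧ not ⌊ γ ≟A δ ⌋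

  ⌊≟A⌋-injective : {f : AArc → AArc} → Injective _≡_ _≡_ f → ∀ γ δ → ⌊ f γ ≟A f δ ⌋ ≡ ⌊ γ ≟A δ ⌋
  ⌊≟A⌋-injective {f} f-injective γ δ = begin
    ⌊ f γ ≟A f δ ⌋       ≡⟨ isYes≗does (f γ ≟A f δ) ⟩
    does (f γ ≟A f δ)    ≡⟨ does-≟-injective _≟A_ _≟A_ f-injective γ δ ⟩
    does (γ ≟A δ)        ≡⟨ isYes≗does (γ ≟A δ) ⟨
    ⌊ γ ≟A δ ⌋           ∎
    where open ≡.≡-Reasoning

  module _ {E : Set} {_≺_ : E → E → Bool} {g : E → E} {R : E → Set}
           (g-monotone : ∀ {e e'} → R e → R e' → (g e ≺ g e') ≡ (e ≺ e'))
           {f : AArc → AArc} (f-injective : Injective _≡_ _≡_ f) where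

    cornerArrows-relabel : ∀ {es} → All (R ∘ proj₁) es →
                           cornerArrows _≺_ (map (Product.map g f) es) ≡ map (Product.map f f) (cornerArrows _≺_ es)
    cornerArrows-relabel {es} rs = begin
      map arcs (filter (T? ∘ isCorner _≺_ (map relabel es)) (cartesianProduct (map relabel es) (map relabel es)))
        ≡⟨ cong (map arcs ∘ filter _) (cartesianProduct-map relabel relabel es es) ⟩
      map arcs (filter (T? ∘ isCorner _≺_ (map relabel es)) (map relabel² (cartesianProduct es es)))
        ≡⟨ cong (map arcs) (filter-map-local (T? ∘ isCorner _≺_ (map relabel es)) (T? ∘ isCorner _≺_ es)
             (cartesianProduct⁺ (≡.setoid _) (≡.setoid _) es es isCorner-relabel)) ⟩
      map arcs (map relabel² (filter (T? ∘ isCorner _≺_ es) (cartesianProduct es es)))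
        ≡⟨ trans (sym (map-∘ _)) (map-∘ _) ⟩
      map (Product.map f f) (map arcs (filter (T? ∘ isCorner _≺_ es) (cartesianProduct es es))) ∎
      where
      open ≡.≡-Reasoning
      relabel : E × AArc → E × AArc
      relabel = Product.map g f
      relabel² : (E × AArc) × (E × AArc) → (E × AArc) × (E × AArc)
      relabel² = Product.map relabel relabel
      arcs : (E × AArc) × (E × AArc) → AArc × AArc
      arcs = Product.map proj₂ proj₂
      isCorner-relabel : ∀ {x y} → x ∈ es → y ∈ es →
                         isCorner _≺_ (map relabel es) (relabel x , relabel y) ≡ isCorner _≺_ es (x , y)
      isCorner-relabel {e , γ} {e' , δ} x∈ y∈ = cong₂ _∧_
        (cong₂ _∧_ (g-monotone re re')
                   (cong not (any-map-local (All.map (λ rz → cong₂ _∧_ (g-monotone re rz) (g-monotone rz re')) rs))))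
        (cong not (⌊≟A⌋-injective f-injective γ δ))
        where
        re  = All.lookup rs x∈
        re' = All.lookup rs y∈

    cornerArrows-map : {S : AArc → Set} (ends : AArc → List (E × AArc)) →
                       (∀ γ → ends (f γ) ≡ map (Product.map g f) (ends γ)) →
                       (∀ {γ} → S γ → All (R ∘ proj₁) (ends γ)) →
                       ∀ {V} → All S V →
                       cornerArrows _≺_ (concatMap ends (map f V)) ≡ map (Product.map f f) (cornerArrows _≺_ (concatMap ends V))
    cornerArrows-map ends ends-f ends-R {V} sV = begin
      cornerArrows _≺_ (concatMap ends (map f V))
        ≡⟨ cong (cornerArrows _≺_) (concatMap-map ends f V) ⟩
      cornerArrows _≺_ (concatMap (ends ∘ f) V)
        ≡⟨ cong (cornerArrows _≺_) (concatMap-cong ends-f V) ⟩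
      cornerArrows _≺_ (concatMap (map (Product.map g f) ∘ ends) V)
        ≡⟨ cong (cornerArrows _≺_) (map-concatMap (Product.map g f) ends V) ⟨
      cornerArrows _≺_ (map (Product.map g f) (concatMap ends V))
        ≡⟨ cornerArrows-relabel (All-concatMap ends-R sV) ⟩
      map (Product.map f f) (cornerArrows _≺_ (concatMap ends V)) ∎
      where open ≡.≡-Reasoning

  cyclicDist : (n : ℕ) → Fin n → Fin n → ℕ
  cyclicDist n c c' = if toℕ c <ⁿ toℕ c' then toℕ c' ∸ toℕ c else (n + toℕ c') ∸ toℕ c

  isNext : (n : ℕ) → (Fin n → Bool) → Fin n → Fin n → Bool
  isNext n present c c' = present c ∧ present c' ∧ not (c ==ᶠ c')
    ∧ not (any (λ c'' → present c'' ∧ not (c'' ==ᶠ c) ∧ (cyclicDist n c c'' <ⁿ cyclicDist n c c')) (allFin n))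

  -- `idealArrows n sp outerSide L` unfolds to
  -- `idealArrowsOn n sp outerSide (λ c → any (λ γ → ⌊ sp c ≟A γ ⌋) L)`.
  idealArrowsOn : (n : ℕ) → (Fin n → AArc) → Bool → (Fin n → Bool) → List (AArc × AArc)
  idealArrowsOn n sp outerSide present = concatMap (λ c → concatMap (λ c' →
    opt (isNext n present c c') (if outerSide then (sp c' , sp c) else (sp c , sp c'))) (allFin n)) (allFin n)

  map-opt : {A B : Set} (f : A → B) (b : Bool) (x : A) → map f (opt b x) ≡ opt b (f x)
  map-opt f true  x = refl
  map-opt f false x = refl

  opt-All : {A : Set} {P : A → Set} (b : Bool) {x : A} → P x → All P (opt b x)
  opt-All true  px = px ∷ []
  opt-All false px = []

  isNext-cong : ∀ n {present present' : Fin n → Bool} → (∀ c → present c ≡ present' c) →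
                ∀ c c' → isNext n present c c' ≡ isNext n present' c c'
  isNext-cong n eq c c' =
    cong₂ _∧_ (eq c) (cong₂ _∧_ (eq c') (cong (not (c ==ᶠ c') ∧_)
      (cong (not ∘ or) (map-cong (λ c'' → cong (_∧ _) (eq c'')) (allFin n)))))

  idealArrowsOn-map : ∀ {n} {f : AArc → AArc} {sp sp' : Fin n → AArc} → (∀ c → f (sp c) ≡ sp' c) →
                      ∀ outerSide {present present' : Fin n → Bool} → (∀ c → present' c ≡ present c) →
                      idealArrowsOn n sp' outerSide present' ≡ map (Product.map f f) (idealArrowsOn n sp outerSide present)
  idealArrowsOn-map {n} {f} {sp} {sp'} f-sp outerSide {present} {present'} same-present = begin
    concatMap (λ c → concatMap (λ c' → opt (isNext n present' c c') (pair′ outerSide c c')) (allFin n)) (allFin n)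
      ≡⟨ concatMap-cong (λ c → concatMap-cong (λ c' →
           cong₂ opt (isNext-cong n same-present c c') (sym (pair-map outerSide c c'))) (allFin n)) (allFin n) ⟩
    concatMap (λ c → concatMap (λ c' → opt (isNext n present c c') (F (pair outerSide c c'))) (allFin n)) (allFin n)
      ≡⟨ concatMap-cong (λ c → trans (concatMap-cong (λ c' → sym (map-opt F (isNext n present c c') _)) (allFin n))
                                       (sym (map-concatMap F _ (allFin n)))) (allFin n) ⟩
    concatMap (λ c → map F (concatMap (λ c' → opt (isNext n present c c') (pair outerSide c c')) (allFin n))) (allFin n)
      ≡⟨ map-concatMap F _ (allFin n) ⟨
    map F (idealArrowsOn n sp outerSide present) ∎
    where
    open ≡.≡-Reasoning
    F : AArc × AArc → AArc × AArc
    F = Product.map f f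
    pair pair′ : Bool → Fin n → Fin n → AArc × AArc
    pair  b c c' = if b then (sp c' , sp c) else (sp c , sp c')
    pair′ b c c' = if b then (sp' c' , sp' c) else (sp' c , sp' c')
    pair-map : ∀ b c c' → F (pair b c c') ≡ pair′ b c c'
    pair-map true  c c' = cong₂ _,_ (f-sp c') (f-sp c)
    pair-map false c c' = cong₂ _,_ (f-sp c) (f-sp c')

  idealArrows-map : ∀ {n} {f : AArc → AArc} → Injective _≡_ _≡_ f →
                    {sp sp' : Fin n → AArc} → (∀ c → f (sp c) ≡ sp' c) → ∀ outerSide L →
                    idealArrows n sp' outerSide (map f L) ≡ map (Product.map f f) (idealArrows n sp outerSide L)
  idealArrows-map {f = f} f-injective {sp} {sp'} f-sp outerSide L =
    idealArrowsOn-map f-sp outerSide (λ c → any-map-local (All.universal (λ γ →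
      trans (cong (λ x → ⌊ x ≟A f γ ⌋) (sym (f-sp c))) (⌊≟A⌋-injective f-injective (sp c) γ)) L))

  flipEndO : OEnd → OEnd
  flipEndO πO = αO
  flipEndO αO = πO
  flipEndO e  = e

  flipEndI : IEnd → IEnd
  flipEndI πI = αI
  flipEndI αI = πI
  flipEndI e  = e

  data PeripheralOrPrüferEndO : OEnd → Set where
    lpO : ∀ k → PeripheralOrPrüferEndO (lpO k)
    πO  : PeripheralOrPrüferEndO πO
    rpO : ∀ k → PeripheralOrPrüferEndO (rpO k)

  data PeripheralOrPrüferEndI : IEnd → Set where
    rpI : ∀ k → PeripheralOrPrüferEndI (rpI k)
    πI  : PeripheralOrPrüferEndI πI
    lpI : ∀ k → PeripheralOrPrüferEndI (lpI k)

  flipEndO-monotone : ∀ {e e'} → PeripheralOrPrüferEndO e → PeripheralOrPrüferEndO e' →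
                      (flipEndO e ≺O flipEndO e') ≡ (e ≺O e')
  flipEndO-monotone (lpO _) (lpO _) = refl
  flipEndO-monotone (lpO _) πO      = refl
  flipEndO-monotone (lpO _) (rpO _) = refl
  flipEndO-monotone πO      (lpO _) = refl
  flipEndO-monotone πO      πO      = refl
  flipEndO-monotone πO      (rpO _) = refl
  flipEndO-monotone (rpO _) (lpO _) = refl
  flipEndO-monotone (rpO _) πO      = refl
  flipEndO-monotone (rpO _) (rpO _) = refl

  flipEndI-monotone : ∀ {e e'} → PeripheralOrPrüferEndI e → PeripheralOrPrüferEndI e' →
                      (flipEndI e ≺I flipEndI e') ≡ (e ≺I e')
  flipEndI-monotone (rpI _) (rpI _) = refl
  flipEndI-monotone (rpI _) πI      = refl
  flipEndI-monotone (rpI _) (lpI _) = refl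
  flipEndI-monotone πI      (rpI _) = refl
  flipEndI-monotone πI      πI      = refl
  flipEndI-monotone πI      (lpI _) = refl
  flipEndI-monotone (lpI _) (rpI _) = refl
  flipEndI-monotone (lpI _) πI      = refl
  flipEndI-monotone (lpI _) (lpI _) = refl

  endsO-flip : ∀ c γ → endsO c (flip γ) ≡ map (Product.map flipEndO flip) (endsO c γ)
  endsO-flip c (arc (bridge a b)) = sym (map-opt _ (a ==ᶠ c) _)
  endsO-flip c (arc (outerP s k)) = sym (trans (map-++ _ (opt (s ==ᶠ c) _) _)
    (cong₂ _++_ (map-opt _ (s ==ᶠ c) _) (map-opt _ (ptO (+ toℕ s ℤ.+ + k) ==ᶠ c) _)))
  endsO-flip c (arc (innerP s k)) = refl
  endsO-flip c (prüferO s)        = sym (map-opt _ (s ==ᶠ c) _)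
  endsO-flip c (adicO s)          = sym (map-opt _ (s ==ᶠ c) _)
  endsO-flip c (prüferI s)        = refl
  endsO-flip c (adicI s)          = refl

  endsI-flip : ∀ d γ → endsI d (flip γ) ≡ map (Product.map flipEndI flip) (endsI d γ)
  endsI-flip d (arc (bridge a b)) = sym (map-opt _ _ _)
  endsI-flip d (arc (innerP s k)) = sym (trans (map-++ _ (opt (s ==ᶠ d) _) _)
    (cong₂ _++_ (map-opt _ (s ==ᶠ d) _) (map-opt _ (ptI (+ toℕ s ℤ.+ + k) ==ᶠ d) _)))
  endsI-flip d (arc (outerP s k)) = refl
  endsI-flip d (prüferI s)        = sym (map-opt _ (s ==ᶠ d) _)
  endsI-flip d (adicI s)          = sym (map-opt _ (s ==ᶠ d) _)
  endsI-flip d (prüferO s)        = refl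
  endsI-flip d (adicO s)          = refl

  endsO-peripheralOrPrüfer : ∀ c {γ} → PeripheralOrPrüfer γ → All (PeripheralOrPrüferEndO ∘ proj₁) (endsO c γ)
  endsO-peripheralOrPrüfer c (outerP s k) = ++⁺ (opt-All (s ==ᶠ c) (rpO k)) (opt-All (ptO (+ toℕ s ℤ.+ + k) ==ᶠ c) (lpO k))
  endsO-peripheralOrPrüfer c (innerP s k) = []
  endsO-peripheralOrPrüfer c (prüferO s)  = opt-All (s ==ᶠ c) πO
  endsO-peripheralOrPrüfer c (prüferI s)  = []

  endsI-peripheralOrPrüfer : ∀ d {γ} → PeripheralOrPrüfer γ → All (PeripheralOrPrüferEndI ∘ proj₁) (endsI d γ)
  endsI-peripheralOrPrüfer d (innerP s k) = ++⁺ (opt-All (s ==ᶠ d) (rpI k)) (opt-All (ptI (+ toℕ s ℤ.+ + k) ==ᶠ d) (lpI k))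
  endsI-peripheralOrPrüfer d (outerP s k) = []
  endsI-peripheralOrPrüfer d (prüferI s)  = opt-All (s ==ᶠ d) πI
  endsI-peripheralOrPrüfer d (prüferO s)  = []

  outerCornerArrows innerCornerArrows : List AArc → List (AArc × AArc)
  outerCornerArrows V = concatMap (λ c → cornerArrows _≺O_ (concatMap (endsO c) V)) (allFin p)
  innerCornerArrows V = concatMap (λ d → cornerArrows _≺I_ (concatMap (endsI d) V)) (allFin q)

  outerCornerArrows-flip : ∀ {V} → All PeripheralOrPrüfer V →
                           outerCornerArrows (map flip V) ≡ map flipArrow (outerCornerArrows V)
  outerCornerArrows-flip pV = trans
    (concatMap-cong (λ c → cornerArrows-map flipEndO-monotone flip-injective
                             (endsO c) (endsO-flip c) (endsO-peripheralOrPrüfer c) pV) (allFin p))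
    (sym (map-concatMap flipArrow _ (allFin p)))

  innerCornerArrows-flip : ∀ {V} → All PeripheralOrPrüfer V →
                           innerCornerArrows (map flip V) ≡ map flipArrow (innerCornerArrows V)
  innerCornerArrows-flip pV = trans
    (concatMap-cong (λ d → cornerArrows-map flipEndI-monotone flip-injective
                             (endsI d) (endsI-flip d) (endsI-peripheralOrPrüfer d) pV) (allFin q))
    (sym (map-concatMap flipArrow _ (allFin q)))

  -- `Quiver.arrows (quiver L)` unfolds to `arrowsOn (deduplicate _≟A_ L)`.
  arrowsOn : List AArc → List (AArc × AArc)
  arrowsOn V = outerCornerArrows V ++ innerCornerArrows V
            ++ idealArrows p prüferO true V ++ idealArrows p adicO true V
            ++ idealArrows q prüferI false V ++ idealArrows q adicI false V

  arrowsOn-flip : ∀ {V} → All PeripheralOrPrüfer V → map flipArrow (arrowsOn V) ↭ arrowsOn (map flip V)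
  arrowsOn-flip {V} pV = begin
    map flipArrow (arrowsOn V)
      ≡⟨ map-arrowsOn ⟩
    m1 ++ m2 ++ m3 ++ m4 ++ m5 ++ m6
      ↭⟨ ++⁺ˡ m1 (++⁺ˡ m2 (↭-trans (shifts m3 m4) (++⁺ˡ m4 (++⁺ˡ m3 (++-comm m5 m6))))) ⟩
    m1 ++ m2 ++ m4 ++ m3 ++ m6 ++ m5
      ≡⟨ arrowsOn-map-flip ⟨
    arrowsOn (map flip V) ∎
    where
    open PermutationReasoning
    m1 = map flipArrow (outerCornerArrows V)
    m2 = map flipArrow (innerCornerArrows V)
    m3 = map flipArrow (idealArrows p prüferO true V)
    m4 = map flipArrow (idealArrows p adicO true V)
    m5 = map flipArrow (idealArrows q prüferI false V)
    m6 = map flipArrow (idealArrows q adicI false V)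
    map-arrowsOn : map flipArrow (arrowsOn V) ≡ m1 ++ m2 ++ m3 ++ m4 ++ m5 ++ m6
    map-arrowsOn =
      trans (map-++ flipArrow (outerCornerArrows V) _) (cong (m1 ++_) (trans (map-++ flipArrow (innerCornerArrows V) _) (cong (m2 ++_)
      (trans (map-++ flipArrow (idealArrows p prüferO true V) _) (cong (m3 ++_)
      (trans (map-++ flipArrow (idealArrows p adicO true V) _) (cong (m4 ++_)
      (map-++ flipArrow (idealArrows q prüferI false V) _))))))))
    arrowsOn-map-flip : arrowsOn (map flip V) ≡ m1 ++ m2 ++ m4 ++ m3 ++ m6 ++ m5
    arrowsOn-map-flip = cong₂ _++_ (outerCornerArrows-flip pV) (cong₂ _++_ (innerCornerArrows-flip pV)
      (cong₂ _++_ (idealArrows-map flip-injective {sp = adicO} (λ _ → refl) true V)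
      (cong₂ _++_ (idealArrows-map flip-injective {sp = prüferO} (λ _ → refl) true V)
      (cong₂ _++_ (idealArrows-map flip-injective {sp = adicI} (λ _ → refl) false V)
                  (idealArrows-map flip-injective {sp = prüferI} (λ _ → refl) false V)))))

  quiver-flip : ∀ {L} → All PeripheralOrPrüfer L → quiver L ≅Q quiver (map flip L)
  quiver-flip {L} pL =
      flip
    , ↭-reflexive (sym flip-deduplicate)
    , ↭-trans (arrowsOn-flip (deduplicate⁺ _≟A_ pL)) (↭-reflexive (cong arrowsOn (sym flip-deduplicate)))
    where
    flip-deduplicate : deduplicate _≟A_ (map flip L) ≡ map flip (deduplicate _≟A_ L)
    flip-deduplicate = deduplicate-map-injective _≟A_ _≟A_ flip-injective L

mainTheorem8 : (p q : ℕ) {{_ : NonZero p}} {{_ : NonZero q}}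
    (T : List (Annulus.OArc p q)) → Annulus.IsTriangulation p q T →
    Annulus._≅Q_ p q (Annulus.quiver p q (Annulus.Dplus p q T)) (Annulus.quiver p q (Annulus.Dminus p q T))
mainTheorem8 p q T _ =
  subst (λ L → quiver (Dplus T) ≅Q quiver L) (sym (Dminus≡map-flip-Dplus p q T))
        (quiver-flip p q (Dplus-peripheralOrPrüfer p q T))
  where open Annulus p q
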